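{- Let $M=(C_1,\ldots,C_n)$ be a multi-context system such that every logic $L_i$ is an ASP logic over an alphabet $\mathcal{A}_i$, and let $1\le k\le n$. Then for every $\pi$: $\pi\in \mathrm{DSD}(k,\emptyset)$ (the output of the distributed symmetry detection algorithm started at context $C_k$ with empty history) if and only if $\pi$ is a partial symmetry of $M$ with respect to the set of contexts $\{C_k\}\cup\{C_i\mid i\in IC(k)\}$.
   Context: Multi-context systems with ASP logics. The alphabets $\mathcal{A}_1,\ldots,\mathcal{A}_n$ are finite and pairwise disjoint sets of atoms. Each context $C_i=(L_i,kb_i,br_i)$ consists of an ASP logic $L_i$ over $\mathcal{A}_i$, a knowledge base $kb_i$, which is a normal logic program over $\mathcal{A}_i$ (a finite set of rules $a\leftarrow b_1,\ldots,b_m,\sim c_1,\ldots,\sim c_l$ with all atoms in $\mathcal{A}_i$, where bodies are sets of literals), and a finite set $br_i$ of bridge rules $a\leftarrow (c_1:b_1),\ldots,(c_j:b_j),\sim(c_{j+1}:b_{j+1}),\ldots,\sim(c_m:b_m)$ with $a\in\mathcal{A}_i$, $1\le c_t\le n$ and $b_t\in\mathcal{A}_{c_t}$. The set of all atoms occurring in $br_i$ (the heads $a$ and all the $b_t$) is $\mathrm{atom}(br_i)$. Applying a permutation $\pi$ of a set of atoms to a rule or bridge rule means replacing each atom $x$ occurring in it by $\pi(x)$ (context indices $c_t$ are unchanged); $\pi(kb_i)$ and $\pi(br_i)$ are the resulting sets of rules. Partial symmetries. A permutation $\pi$ of a set $S\subseteq\bigcup_{i=1}^n\mathcal{A}_i$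 is a partial symmetry of $M$ with respect to a set of contexts $\{C_{i_1},\ldots,C_{i_m}\}$ iff for every $1\le t\le m$: $\mathcal{A}_{i_t}\cup\mathrm{atom}(br_{i_t})\subseteq S$, $\pi(kb_{i_t})=kb_{i_t}$ and $\pi(br_{i_t})=br_{i_t}$. Write $\mathrm{dom}(\pi)=S$. For partial symmetries $\pi,\sigma$ with $\pi(a)=\sigma(a)$ for all $a\in\mathrm{dom}(\pi)\cap\mathrm{dom}(\sigma)$, the join $\pi\bowtie\sigma$ is the map $\theta$ on $\mathrm{dom}(\pi)\cup\mathrm{dom}(\sigma)$ with $\theta(a)=\pi(a)$ for $a\in\mathrm{dom}(\pi)$ and $\theta(a)=\sigma(a)$ for $a\in\mathrm{dom}(\sigma)$; otherwise the join is undefined. For sets of partial symmetries, $\Pi\bowtie\Sigma=\{\pi\bowtie\sigma\mid \pi\in\Pi,\sigma\in\Sigma,\ \pi\bowtie\sigma \text{ defined}\}$. Import closure. The import neighbourhood $In(k)$ is the set of all context indices $c$ such that some context atom $(c:b)$ occurs (positively or default-negated) in the body of a bridge rule of $br_k$. The import closure $IC(k)$ is the smallest set $S$ with $k\in S$ and such that $i\in S$ implies $In(i)\subseteq S$. Algorithm. Let $\mathrm{GAP}(C_k)$ be the set of all partial symmetries of $M$ with respect to $\{C_k\}$. For a set (history) $H\subseteq\{1,\ldots,n\}$, the algorithm DSD run at context $C_k$ with input $H$ works as follows: set $H:=H\cup\{k\}$ and $\Pi:=\mathrm{GAP}(C_k)$; then for each $i\in In(k)\setminus H$ (in any order) set $\Pi:=\Pi\bowtie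 \mathrm{DSD}(i,H)$; finally return $\Pi$. Its output is denoted $\mathrm{DSD}(k,H)$. -}

module Defs where

open import Data.Nat.Base using (ℕ)
open import Data.Fin.Base using (Fin)
open import Data.Fin.Properties using () renaming (_≟_ to _≟ᶠ_)
open import Data.Fin.Subset as Subset
  using (Subset; _∈_; _∉_; _⊆_; _∩_; _⊃_; Empty; ⁅_⁆; ⋃)
open import Data.Fin.Subset.Properties
  using (_∈?_; p⊆p∪q; x∈p∪q⁺; x∈⁅x⁆)
open import Data.Fin.Subset.Induction using (⊃-wellFounded)
open import Data.List.Base using (List; []; _∷_; _++_; map; tabulate; filter; allFin)
open import Data.List.Membership.Propositional using () renaming (_∈_ to _∈ˡ_)
open import Data.List.Membership.Propositional.Properties using (∈-allFin; ∈-filter⁺; ∈-filter⁻)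
open import Data.List.Relation.Binary.BagAndSetEquality using (_∼[_]_; set)
open import Data.List.Relation.Unary.All as All using (All; []; _∷_)
open import Data.List.Relation.Unary.Any as Any using (Any)
open import Data.List.Relation.Unary.Unique.Propositional using (Unique)
open import Data.List.Relation.Unary.Unique.Propositional.Properties using (filter⁺; allFin⁺)
open import Data.Product.Base using (Σ; ∃; ∃₂; _×_; _,_; proj₁; proj₂; map₂)
open import Data.Sum.Base using (_⊎_; inj₁; inj₂)
open import Function.Base using (_∘_)
open import Function.Bundles using (_⇔_; mk⇔; module Equivalence)
open import Induction.WellFounded using (Acc; acc)
open import Level using (0ℓ)
open import Relation.Binary.PropositionalEquality using (_≡_; _≢_)
open import Relation.Nullary using (Dec; ¬?; _×-dec_)
open import Relation.Unary using (Pred; ｛_｝)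

private variable
  n N : ℕ
  A A′ B B′ : Set

-- A rule  head ← pos, ∼ neg.  Normal rules have B = A; bridge rules have as
-- body elements pairs (c : b) of a context index and an atom.
record Rule (A B : Set) : Set where
  constructor _←_,∼_
  field
    head : A
    pos  : List B
    neg  : List B

  body : List B
  body = pos ++ neg

open Rule public

mapRule : (A → A′) → (B → B′) → Rule A B → Rule A′ B′
mapRule f g (a ← bs ,∼ cs) = f a ← map g bs ,∼ map g cs

-- Bodies are sets of literals and programs are sets of rules, so the lists
-- representing them are compared up to order and repetition.
_≈ʳ_ : Rule A B → Rule A B → Set
r ≈ʳ s = head r ≡ head s × pos r ∼[ set ] pos s × neg r ∼[ set ] neg s

_≈ᵖ_ : List (Rule A B) → List (Rule A B) → Set
P ≈ᵖ Q = All (λ r → Any (r ≈ʳ_) Q) P × All (λ s → Any (_≈ʳ s) P) Q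

-- All atoms are drawn from an ambient finite set Fin N, of which the alphabets
-- are subsets.
NormalRule : ℕ → Set
NormalRule N = Rule (Fin N) (Fin N)

BridgeRule : ℕ → ℕ → Set
BridgeRule n N = Rule (Fin N) (Fin n × Fin N)

record Logic : Set₁ where
  field
    KB  : Set
    BS  : Set
    ACC : KB → BS → Set

NormalProgram : Subset N → Set
NormalProgram {N} 𝒜 =
  Σ (List (NormalRule N)) (All λ r → head r ∈ 𝒜 × All (_∈ 𝒜) (body r))

-- Y is a model of the Gelfond–Lifschitz reduct of P with respect to X.
ModelOfReduct : List (NormalRule N) → (X Y : Subset N) → Set
ModelOfReduct P X Y =
  All (λ r → All (_∉ X) (neg r) → All (_∈ Y) (pos r) → head r ∈ Y) P

AnswerSet : List (NormalRule N) → Subset N → Set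
AnswerSet P X = ModelOfReduct P X X × (∀ Y → ModelOfReduct P X Y → X ⊆ Y)

ASP : Subset N → Logic
ASP 𝒜 = record
  { KB  = NormalProgram 𝒜
  ; BS  = ∃ (_⊆ 𝒜)
  ; ACC = λ P X → AnswerSet (proj₁ P) (proj₁ X)
  }

record MCS (n N : ℕ) : Set where
  field
    𝒜          : Fin n → Subset N
    𝒜-disjoint : ∀ {i j} → i ≢ j → Empty (𝒜 i ∩ 𝒜 j)

  L : Fin n → Logic
  L i = ASP (𝒜 i)

  field
    kb      : ∀ i → Logic.KB (L i)
    br      : Fin n → List (BridgeRule n N)
    br-over : ∀ i → All (λ r → head r ∈ 𝒜 i × All (λ (c , b) → b ∈ 𝒜 c) (body r)) (br i)

-- A map on dom.  Only the values of fun on dom are meaningful: nothing below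
-- depends on the values elsewhere.
record PartialMap (N : ℕ) : Set where
  field
    dom : Subset N
    fun : Fin N → Fin N

open PartialMap public

record IsPermutation (π : PartialMap N) : Set where
  field
    closed     : ∀ {a} → a ∈ dom π → fun π a ∈ dom π
    injective  : ∀ {a b} → a ∈ dom π → b ∈ dom π → fun π a ≡ fun π b → a ≡ b
    surjective : ∀ {b} → b ∈ dom π → ∃ λ a → a ∈ dom π × fun π a ≡ b

record _⋈_↦_ (π σ θ : PartialMap N) : Set where
  field
    agree : ∀ {a} → a ∈ dom π → a ∈ dom σ → fun π a ≡ fun σ a
    dom-θ : dom θ ≡ dom π Subset.∪ dom σ
    θ≗π   : ∀ {a} → a ∈ dom π → fun θ a ≡ fun π a
    θ≗σ   : ∀ {a} → a ∈ dom σ → fun θ a ≡ fun σ a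

_⋈_ : Pred (PartialMap N) 0ℓ → Pred (PartialMap N) 0ℓ → Pred (PartialMap N) 0ℓ
(Π ⋈ Σ′) θ = ∃₂ λ π σ → Π π × Σ′ σ × π ⋈ σ ↦ θ

module _ (M : MCS n N) where
  open MCS M

  AtomOfBr : Fin n → Pred (Fin N) 0ℓ
  AtomOfBr i a = Any (λ r → a ≡ head r ⊎ a ∈ˡ map proj₂ (body r)) (br i)

  record IsPartialSymmetry (I : Pred (Fin n) 0ℓ) (π : PartialMap N) : Set where
    field
      dom⊆⋃𝒜      : dom π ⊆ ⋃ (tabulate 𝒜)
      permutation : IsPermutation π
      𝒜⊆dom       : ∀ {i} → I i → 𝒜 i ⊆ dom π
      atom⊆dom    : ∀ {i a} → I i → AtomOfBr i a → a ∈ dom π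
      fixes-kb    : ∀ {i} → I i →
                    map (mapRule (fun π) (fun π)) (proj₁ (kb i)) ≈ᵖ proj₁ (kb i)
      fixes-br    : ∀ {i} → I i →
                    map (mapRule (fun π) (map₂ (fun π))) (br i) ≈ᵖ br i

  In : Fin n → Pred (Fin n) 0ℓ
  In k c = Any (λ r → c ∈ˡ map proj₁ (body r)) (br k)

  data IC (k : Fin n) : Pred (Fin n) 0ℓ where
    start : IC k k
    step  : ∀ {i j} → IC k i → In i j → IC k j

  GAP : Fin n → Pred (PartialMap N) 0ℓ
  GAP k = IsPartialSymmetry ｛ k ｝

  -- The lists that enumerate In(k) ∖ H, each being one possible order in which
  -- the loop of the algorithm can process this set.
  record Order (k : Fin n) (H : Subset n) : Set where
    field
      contexts : List (Fin n)
      unique   : Unique contexts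
      complete : ∀ {i} → i ∈ˡ contexts ⇔ (In k i × i ∉ H)

  open Order

  -- The executions of the algorithm at context k with input history H: they
  -- differ in the orders chosen by the loops of the individual calls.
  data Run (k : Fin n) (H : Subset n) : Set where
    call : let H′ = H Subset.∪ ⁅ k ⁆ in
           (o : Order k H′) → All (λ i → Run i H′) (contexts o) → Run k H

  mutual
    DSD : ∀ {k H} → Run k H → Pred (PartialMap N) 0ℓ
    DSD {k} (call o rs) = loop (GAP k) rs

    loop : ∀ {is H} → Pred (PartialMap N) 0ℓ → All (λ i → Run i H) is →
           Pred (PartialMap N) 0ℓ
    loop Π []       = Π
    loop Π (r ∷ rs) = loop (Π ⋈ DSD r) rs

  -- The algorithm terminates: executions exist for all inputs.
  In? : ∀ k c → Dec (In k c)
  In? k c = Any.any? (λ r → Any.any? (c ≟ᶠ_) (map proj₁ (body r))) (br k)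

  someOrder : ∀ k H → Order k H
  someOrder k H = record
    { contexts = filter P? (allFin n)
    ; unique   = filter⁺ P? (allFin⁺ n)
    ; complete = mk⇔ (proj₂ ∘ ∈-filter⁻ P? {xs = allFin n}) (∈-filter⁺ P? (∈-allFin _))
    }
    where
    P? : ∀ i → Dec (In k i × i ∉ H)
    P? i = In? k i ×-dec ¬? (i ∈? H)

  someRun : ∀ k H → Run k H
  someRun k H = go k H (⊃-wellFounded _)
    where
    go : ∀ k H → Acc _⊃_ (H Subset.∪ ⁅ k ⁆) → Run k H
    go k H (acc rec) = call o (All.tabulate λ {i} i∈o →
      go i H′ (rec ( p⊆p∪q ⁅ i ⁆
                   , i
                   , x∈p∪q⁺ (inj₂ (x∈⁅x⁆ i))
                   , proj₂ (Equivalence.to (complete o) i∈o))))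
      where
      H′ = H Subset.∪ ⁅ k ⁆
      o  = someOrder k H′

{-# OPTIONS --safe #-}

-- Every partial symmetry π for a union of sets of contexts is the join π ⋈ π of
-- partial symmetries for the parts.  Conversely, when permutations π of S and σ of T
-- agree on S ∩ T, that intersection is closed under π; by finiteness π permutes
-- it, so π maps S ∖ T to itself, likewise for σ, and π ⋈ σ is a permutation.
-- Hence an execution returns exactly the partial symmetries for the contexts it
-- calls.  The history passed to a call contains only the contexts on the path
-- from k to it, so the contexts called are the ends of simple paths from k in
-- the import graph; removing cycles from a path shows that these are all of IC(k).

module Submission where

open import Defs
open import Data.Nat.Base using (ℕ)
open import Data.Nat.Properties using (1+n≰n)
open import Data.Fin.Base using (Fin; punchOut)
open import Data.Fin.Properties using (_≟_; any?; injective⇒≤; punchOut-injective)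
open import Data.Fin.Subset using (⊥)
import Data.Fin.Subset as Subset
open import Data.Fin.Subset.Properties using (_∈?_; ∉⊥; x∈p∪q⁻; x∈p∩q⁺; x∈p∩q⁻; x∈⁅y⁆⇒x≡y; p⊆p∪q; q⊆p∪q; ∪-idem; ∪-comm)
open import Data.List.Base using (map)
open import Data.List.Membership.Propositional using (lose) renaming (_∈_ to _∈ˡ_)
open import Data.List.Membership.Propositional.Properties using (∈-map⁺)
open import Data.List.Properties using (map-cong-local)
open import Data.List.Relation.Unary.All as All using (All; []; _∷_)
open import Data.List.Relation.Unary.All.Properties using (++⁻ˡ; ++⁻ʳ)
open import Data.List.Relation.Unary.Any using (here; there)
open import Data.Product.Base using (∃; _×_; _,_; proj₁; proj₂; map₂)
open import Data.Sum.Base using (_⊎_; inj₁; inj₂; [_,_]′)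
open import Function.Base using (_∘_; _∘′_; id)
open import Function.Bundles using (_⇔_; mk⇔; module Equivalence)
open import Function.Definitions using (Injective)
open import Level using (0ℓ)
open import Relation.Binary.Construct.Closure.ReflexiveTransitive as Star using (Star; ε; _◅_; _◅◅_)
open import Relation.Binary.PropositionalEquality using (_≡_; refl; sym; trans; cong; subst)
open import Relation.Nullary using (yes; no; contradiction)
open import Relation.Unary using (Pred; _∈_; _∪_; _⊆_; ∅; ｛_｝)

private variable
  n N : ℕ
  π σ θ : PartialMap N

-- If `y` had no preimage, punching it out of the codomain would give an injection into a smaller
-- finite set.
injective⇒surjective : (f : Fin n → Fin n) → Injective _≡_ _≡_ f → ∀ y → ∃ λ x → f x ≡ y
injective⇒surjective {ℕ.suc n} f f-injective y with any? (λ x → f x ≟ y)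
... | yes hit = hit
... | no ¬hit = contradiction
  (injective⇒≤ {f = λ x → punchOut (y≢f x)}
    (λ eq → f-injective (punchOut-injective (y≢f _) (y≢f _) eq)))
  1+n≰n
  where
  y≢f : ∀ x → y ≡ f x → _
  y≢f x y≡fx = ¬hit (x , sym y≡fx)

module _ (S : Subset.Subset N) (f : Fin N → Fin N)
         (closed : ∀ {a} → a Subset.∈ S → f a Subset.∈ S)
         (injective : ∀ {a b} → a Subset.∈ S → b Subset.∈ S → f a ≡ f b → a ≡ b) where

  private
    -- Fixing the points outside `S` keeps the map injective, since `f` never leaves `S`, and makes
    -- it total on `Fin N`.
    extend : Fin N → Fin N
    extend x with x ∈? S
    ... | yes _ = f x
    ... | no  _ = x

    extend-injective : Injective _≡_ _≡_ extend
    extend-injective {x} {y} eq with x ∈? S | y ∈? S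
    ... | yes x∈S | yes y∈S = injective x∈S y∈S eq
    ... | yes x∈S | no  y∉S = contradiction (subst (Subset._∈ S) eq (closed x∈S)) y∉S
    ... | no  x∉S | yes y∈S = contradiction (subst (Subset._∈ S) (sym eq) (closed y∈S)) x∉S
    ... | no  _   | no  _   = eq

  injective-on⇒surjective-on : ∀ {b} → b Subset.∈ S → ∃ λ a → a Subset.∈ S × f a ≡ b
  injective-on⇒surjective-on {b} b∈S with injective⇒surjective extend extend-injective b
  ... | a , eq with a ∈? S
  ...   | yes a∈S = a , a∈S , eq
  ...   | no  a∉S = contradiction (subst (Subset._∈ S) (sym eq) b∈S) a∉S

⋈-comm : π ⋈ σ ↦ θ → σ ⋈ π ↦ θ
⋈-comm {π = π} {σ} j = record
  { agree = λ a∈σ a∈π → sym (agree a∈π a∈σ)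
  ; dom-θ = trans dom-θ (∪-comm (dom π) (dom σ))
  ; θ≗π   = θ≗σ
  ; θ≗σ   = θ≗π
  }
  where open _⋈_↦_ j

⋈-idem : (π : PartialMap N) → π ⋈ π ↦ π
⋈-idem π = record
  { agree = λ _ _ → refl
  ; dom-θ = sym (∪-idem (dom π))
  ; θ≗π   = λ _ → refl
  ; θ≗σ   = λ _ → refl
  }

⋈-domˡ : π ⋈ σ ↦ θ → dom π Subset.⊆ dom θ
⋈-domˡ {σ = σ} j a∈π = subst (_ Subset.∈_) (sym (_⋈_↦_.dom-θ j)) (p⊆p∪q (dom σ) a∈π)

⋈-domʳ : π ⋈ σ ↦ θ → dom σ Subset.⊆ dom θ
⋈-domʳ = ⋈-domˡ ∘ ⋈-comm

⋈-dom⁻ : ∀ {a} → π ⋈ σ ↦ θ → a Subset.∈ dom θ → a Subset.∈ dom π ⊎ a Subset.∈ dom σ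
⋈-dom⁻ {π = π} {σ} j = x∈p∪q⁻ (dom π) (dom σ) ∘ subst (_ Subset.∈_) (_⋈_↦_.dom-θ j)

-- By agreement with `σ`, `fun π` maps the intersection of the domains injectively into itself,
-- hence onto itself. So `fun π a` has a preimage there, which injectivity on `dom π` identifies
-- with `a`.
⋈-reflects-∈ : IsPermutation π → IsPermutation σ → π ⋈ σ ↦ θ →
               ∀ {a} → a Subset.∈ dom π → fun π a Subset.∈ dom σ → a Subset.∈ dom σ
⋈-reflects-∈ {π = π} {σ} pπ pσ j {a} a∈π πa∈σ
  with injective-on⇒surjective-on (dom π Subset.∩ dom σ) (fun π) closed′ injective′
         (x∈p∩q⁺ (closed pπ a∈π , πa∈σ))
  where
  open IsPermutation
  split : ∀ {x} → x Subset.∈ dom π Subset.∩ dom σ → x Subset.∈ dom π × x Subset.∈ dom σ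
  split = x∈p∩q⁻ (dom π) (dom σ)
  closed′ : ∀ {x} → x Subset.∈ dom π Subset.∩ dom σ → fun π x Subset.∈ dom π Subset.∩ dom σ
  closed′ x∈ with x∈π , x∈σ ← split x∈ = x∈p∩q⁺
    (closed pπ x∈π , subst (Subset._∈ dom σ) (sym (_⋈_↦_.agree j x∈π x∈σ)) (closed pσ x∈σ))
  injective′ : ∀ {x y} → x Subset.∈ dom π Subset.∩ dom σ → y Subset.∈ dom π Subset.∩ dom σ →
               fun π x ≡ fun π y → x ≡ y
  injective′ x∈ y∈ = injective pπ (proj₁ (split x∈)) (proj₁ (split y∈))
... | b , b∈ , πb≡πa with b∈π , b∈σ ← x∈p∩q⁻ (dom π) (dom σ) b∈ =
  subst (Subset._∈ dom σ) (IsPermutation.injective pπ b∈π a∈π πb≡πa) b∈σ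

⋈-permutation : IsPermutation π → IsPermutation σ → π ⋈ σ ↦ θ → IsPermutation θ
⋈-permutation {π = π} {σ} {θ} pπ pσ j = record
  { closed     = [ closedˡ pπ j , closedˡ pσ (⋈-comm j) ]′ ∘ ⋈-dom⁻ j
  ; injective  = λ a∈ b∈ → injective′ (⋈-dom⁻ j a∈) (⋈-dom⁻ j b∈)
  ; surjective = [ surjectiveˡ pπ j , surjectiveˡ pσ (⋈-comm j) ]′ ∘ ⋈-dom⁻ j
  }
  where
  open IsPermutation
  open _⋈_↦_

  -- This helper and the next two bind their own `π` and `σ`, so that `⋈-comm` turns them into
  -- statements about the right factor.
  closedˡ : ∀ {π σ a} → IsPermutation π → π ⋈ σ ↦ θ → a Subset.∈ dom π → fun θ a Subset.∈ dom θ
  closedˡ p j a∈ = ⋈-domˡ j (subst (Subset._∈ _) (sym (θ≗π j a∈)) (closed p a∈))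

  surjectiveˡ : ∀ {π σ b} → IsPermutation π → π ⋈ σ ↦ θ → b Subset.∈ dom π →
                ∃ λ a → a Subset.∈ dom θ × fun θ a ≡ b
  surjectiveˡ p j b∈ with a , a∈ , πa≡b ← surjective p b∈ =
    a , ⋈-domˡ j a∈ , trans (θ≗π j a∈) πa≡b

  injectiveˡ : ∀ {π σ a b} → IsPermutation π → π ⋈ σ ↦ θ → a Subset.∈ dom π → b Subset.∈ dom π →
               fun θ a ≡ fun θ b → a ≡ b
  injectiveˡ p j a∈ b∈ eq = injective p a∈ b∈ (trans (sym (θ≗π j a∈)) (trans eq (θ≗π j b∈)))

  -- The common value is both `fun π a` and `fun σ b`, so it lies in `dom σ`. Then `a` lies in
  -- `dom σ` too, where `σ` is injective.
  injectiveˣ : ∀ {a b} → a Subset.∈ dom π → b Subset.∈ dom σ → fun θ a ≡ fun θ b → a ≡ b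
  injectiveˣ a∈π b∈σ eq = injectiveˡ pσ (⋈-comm j) (⋈-reflects-∈ pπ pσ j a∈π πa∈σ) b∈σ eq
    where
    πa∈σ = subst (Subset._∈ dom σ)
      (trans (sym (θ≗σ j b∈σ)) (trans (sym eq) (θ≗π j a∈π))) (closed pσ b∈σ)

  injective′ : ∀ {a b} → a Subset.∈ dom π ⊎ a Subset.∈ dom σ → b Subset.∈ dom π ⊎ b Subset.∈ dom σ →
               fun θ a ≡ fun θ b → a ≡ b
  injective′ (inj₁ a∈) (inj₁ b∈) eq = injectiveˡ pπ j a∈ b∈ eq
  injective′ (inj₁ a∈) (inj₂ b∈) eq = injectiveˣ a∈ b∈ eq
  injective′ (inj₂ a∈) (inj₁ b∈) eq = sym (injectiveˣ b∈ a∈ (sym eq))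
  injective′ (inj₂ a∈) (inj₂ b∈) eq = injectiveˡ pσ (⋈-comm j) a∈ b∈ eq

-- Agreement is asked only at what occurs in the rule, because partial maps are meaningful only on
-- their domains.
mapRule-cong : ∀ {A A′ B B′ : Set} {f f′ : A → A′} {g g′ : B → B′} (r : Rule A B) →
               f (head r) ≡ f′ (head r) → All (λ b → g b ≡ g′ b) (body r) →
               mapRule f g r ≡ mapRule f′ g′ r
mapRule-cong (a ← bs ,∼ cs) fa≡f′a gs≗g′s
  rewrite fa≡f′a
        | map-cong-local (++⁻ˡ bs gs≗g′s)
        | map-cong-local (++⁻ʳ bs gs≗g′s) = refl

module _ (M : MCS n N) where
  open MCS M
  open IsPartialSymmetry

  restrict : ∀ {I J : Pred (Fin n) 0ℓ} → I ⊆ J → IsPartialSymmetry M J π → IsPartialSymmetry M I π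
  restrict I⊆J s = record
    { dom⊆⋃𝒜      = dom⊆⋃𝒜 s
    ; permutation = permutation s
    ; 𝒜⊆dom       = 𝒜⊆dom s ∘′ I⊆J
    ; atom⊆dom    = atom⊆dom s ∘′ I⊆J
    ; fixes-kb    = fixes-kb s ∘′ I⊆J
    ; fixes-br    = fixes-br s ∘′ I⊆J
    }

  module _ {I : Pred (Fin n) 0ℓ} {f : Fin N → Fin N} (s : IsPartialSymmetry M I π)
           (f≗π : ∀ {a} → a Subset.∈ dom π → f a ≡ fun π a) where

    -- Meant for `f = fun θ` with `θ` a join. All atoms of the program lie in `dom π`, so `f` and
    -- `fun π` produce the same list of rules.
    agreeing-fixes-kb : ∀ {i} → I i → map (mapRule f f) (proj₁ (kb i)) ≈ᵖ proj₁ (kb i)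
    agreeing-fixes-kb {i} i∈I = subst (_≈ᵖ proj₁ (kb i)) (sym fkb≡πkb) (fixes-kb s i∈I)
      where
      fkb≡πkb : map (mapRule f f) (proj₁ (kb i)) ≡ map (mapRule (fun π) (fun π)) (proj₁ (kb i))
      fkb≡πkb = map-cong-local (All.map
        (λ {r} (h∈ , b∈) → mapRule-cong {f = f} {fun π} r
          (f≗π (𝒜⊆dom s i∈I h∈)) (All.map (f≗π ∘ 𝒜⊆dom s i∈I) b∈))
        (proj₂ (kb i)))

    agreeing-fixes-br : ∀ {i} → I i → map (mapRule f (map₂ f)) (br i) ≈ᵖ br i
    agreeing-fixes-br {i} i∈I = subst (_≈ᵖ br i) (sym fbr≡πbr) (fixes-br s i∈I)
      where
      fbr≡πbr : map (mapRule f (map₂ f)) (br i) ≡ map (mapRule (fun π) (map₂ (fun π))) (br i)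
      fbr≡πbr = map-cong-local (All.tabulate λ {r} r∈ → mapRule-cong {f = f} {fun π} r
        (f≗π (atom⊆dom s i∈I (lose r∈ (inj₁ refl))))
        (All.tabulate λ {(c , b)} cb∈ →
          cong (c ,_) (f≗π (atom⊆dom s i∈I (lose r∈ (inj₂ (∈-map⁺ proj₂ cb∈)))))))

  ⋈-symmetry : ∀ {I J : Pred (Fin n) 0ℓ} → IsPartialSymmetry M I π → IsPartialSymmetry M J σ →
               π ⋈ σ ↦ θ → IsPartialSymmetry M (I ∪ J) θ
  ⋈-symmetry s t j = record
    { dom⊆⋃𝒜      = [ dom⊆⋃𝒜 s , dom⊆⋃𝒜 t ]′ ∘ ⋈-dom⁻ j
    ; permutation = ⋈-permutation (permutation s) (permutation t) j
    ; 𝒜⊆dom       = λ { (inj₁ i∈) → ⋈-domˡ j ∘ 𝒜⊆dom s i∈ ; (inj₂ i∈) → ⋈-domʳ j ∘ 𝒜⊆dom t i∈ }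
    ; atom⊆dom    = λ { (inj₁ i∈) → ⋈-domˡ j ∘ atom⊆dom s i∈ ; (inj₂ i∈) → ⋈-domʳ j ∘ atom⊆dom t i∈ }
    ; fixes-kb    = [ agreeing-fixes-kb s θ≗π , agreeing-fixes-kb t θ≗σ ]′
    ; fixes-br    = [ agreeing-fixes-br s θ≗π , agreeing-fixes-br t θ≗σ ]′
    }
    where open _⋈_↦_ j

  mutual
    -- All contexts in the call tree of a run, its root included. This set separates the algebra of
    -- joins from reachability in the import graph.
    called : ∀ {k H} → Run M k H → Pred (Fin n) 0ℓ
    called {k} (call _ rs) = ｛ k ｝ ∪ calledBy rs

    calledBy : ∀ {is H} → All (λ i → Run M i H) is → Pred (Fin n) 0ℓ
    calledBy []       = ∅
    calledBy (r ∷ rs) = called r ∪ calledBy rs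

  mutual
    DSD-sound : ∀ {k H} (r : Run M k H) → DSD M r ⊆ IsPartialSymmetry M (called r)
    DSD-sound (call _ rs) = loop-sound rs id

    -- Stated for an arbitrary accumulator, since each iteration replaces `Π` by a join and enlarges
    -- `I`.
    loop-sound : ∀ {is H I} {Π : Pred (PartialMap N) 0ℓ} (rs : All (λ i → Run M i H) is) →
                 Π ⊆ IsPartialSymmetry M I → loop M Π rs ⊆ IsPartialSymmetry M (I ∪ calledBy rs)
    loop-sound [] Π⊆ π∈ = restrict [ id , (λ ()) ]′ (Π⊆ π∈)
    loop-sound (r ∷ rs) Π⊆ π∈ = restrict
      [ inj₁ ∘ inj₁ , [ inj₁ ∘ inj₂ , inj₂ ]′ ]′
      (loop-sound rs (λ (_ , _ , s , t , j) → ⋈-symmetry (Π⊆ s) (DSD-sound r t) j) π∈)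

  mutual
    DSD-complete : ∀ {k H} (r : Run M k H) → IsPartialSymmetry M (called r) ⊆ DSD M r
    DSD-complete (call _ rs) s = loop-complete rs (restrict inj₁ s) (restrict inj₂ s)

    loop-complete : ∀ {is H} {Π : Pred (PartialMap N) 0ℓ} (rs : All (λ i → Run M i H) is) →
                    π ∈ Π → IsPartialSymmetry M (calledBy rs) π → π ∈ loop M Π rs
    loop-complete [] π∈ _ = π∈
    loop-complete {π = π} (r ∷ rs) π∈ s = loop-complete rs
      -- The whole of `π` serves as both factors: a domain may be larger than the contexts at hand
      -- require.
      (π , π , π∈ , DSD-complete r (restrict inj₁ s) , ⋈-idem π) (restrict inj₂ s)

  -- Only the target of a step must avoid `H`, so a path may still start at a context that has just
  -- entered the history.
  ImportAvoiding : Subset.Subset n → Fin n → Fin n → Set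
  ImportAvoiding H i j = In M i j × j Subset.∉ H

  mutual
    called⇒path : ∀ {k H i} (r : Run M k H) → called r i → Star (In M) k i
    called⇒path (call _ _) (inj₁ refl) = ε
    called⇒path (call o rs) (inj₂ i∈)
      with j , j∈o , p ← calledBy⇒path rs i∈ =
      proj₁ (Equivalence.to (Order.complete o) j∈o) ◅ p

    calledBy⇒path : ∀ {is H i} (rs : All (λ j → Run M j H) is) → calledBy rs i →
                    ∃ λ j → j ∈ˡ is × Star (In M) j i
    calledBy⇒path (r ∷ _) (inj₁ i∈) = _ , here refl , called⇒path r i∈
    calledBy⇒path (_ ∷ rs) (inj₂ i∈) with j , j∈ , p ← calledBy⇒path rs i∈ = j , there j∈ , p

  -- If the path returns to k, it is cut at the last visit to k.
  avoid : ∀ {H i j} k → Star (ImportAvoiding H) j i →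
          let H′ = H Subset.∪ Subset.⁅ k ⁆ in
          Star (ImportAvoiding H′) j i ⊎ Star (ImportAvoiding H′) k i
  avoid k ε = inj₁ ε
  avoid {H} k (_◅_ {j = j} (j∈In , j∉H) p) with avoid k p
  ... | inj₂ q = inj₂ q
  ... | inj₁ q with j ≟ k
  ...   | yes refl = inj₂ q
  ...   | no  j≢k  = inj₁ ((j∈In , [ j∉H , j≢k ∘ x∈⁅y⁆⇒x≡y k ]′ ∘ x∈p∪q⁻ H Subset.⁅ k ⁆) ◅ q)

  mutual
    -- Induction on the run. Once the path avoids the enlarged history, its first step leads to a
    -- context that the loop calls, and the rest is a path for that call.
    path⇒called : ∀ {k H i} (r : Run M k H) → Star (ImportAvoiding H) k i → called r i
    -- As `p` starts at `k`, both outcomes of `avoid` are paths from `k`.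
    path⇒called {k} (call o rs) p with [ id , id ]′ (avoid k p)
    ... | ε     = inj₁ refl
    ... | e ◅ q = inj₂ (path⇒calledBy rs (Equivalence.from (Order.complete o) e) q)

    path⇒calledBy : ∀ {is H i j} (rs : All (λ l → Run M l H) is) → j ∈ˡ is →
                    Star (ImportAvoiding H) j i → calledBy rs i
    path⇒calledBy (r ∷ _)  (here refl) p = inj₁ (path⇒called r p)
    path⇒calledBy (_ ∷ rs) (there j∈)  p = inj₂ (path⇒calledBy rs j∈ p)

  IC⇒path : ∀ {k i} → IC M k i → Star (In M) k i
  IC⇒path start      = ε
  IC⇒path (step p e) = IC⇒path p ◅◅ e ◅ ε

  -- `IC` grows at its end but `Star` at its front, so the part already walked is carried as an
  -- accumulator.
  path⇒IC : ∀ {k i j} → IC M k i → Star (In M) i j → IC M k j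
  path⇒IC p ε       = p
  path⇒IC p (e ◅ q) = path⇒IC (step p e) q

  called⊆IC : ∀ {k H} (r : Run M k H) → called r ⊆ IC M k
  called⊆IC r = path⇒IC start ∘ called⇒path r

  IC⊆called : ∀ {k} (r : Run M k ⊥) → IC M k ⊆ called r
  -- Every step avoids the empty history.
  IC⊆called r = path⇒called r ∘ Star.map (_, ∉⊥) ∘ IC⇒path

theorem4p5 : ∀ {n N : ℕ} (M : MCS n N) (k : Fin n) (r : Run M k ⊥) (π : PartialMap N) →
    π ∈ DSD M r ⇔ IsPartialSymmetry M (｛ k ｝ ∪ IC M k) π
theorem4p5 M k r π = mk⇔
  -- `k` belongs to `IC M k` by `start`, so both members of the union lie in `called r`.
  (restrict M [ (λ { refl → IC⊆called M r start }) , IC⊆called M r ]′ ∘ DSD-sound M r)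
  (DSD-complete M r ∘ restrict M (inj₂ ∘ called⊆IC M r))
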